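{- There exist a constant $c>0$ and an integer $n_0$ such that for every integer $n\ge n_0$, every DNNF circuit expressing the Boolean function $\mathrm{lin}_n$ has size at least $2^{cn}$. In other words, every family $\{\Gamma_n\}_{n\in\mathbb{N}}$ of DNNF circuits such that each $\Gamma_n$ expresses $\mathrm{lin}_n$ has size $2^{\Omega(n)}$.
   Context: For $n\in\mathbb{N}$, $\mathrm{lin}_n$ is the Boolean function over the variables $\{x_{i,j} : i,j\in[n],\ i<j\}$ (where $[n]=\{1,\dots,n\}$) such that an assignment $\alpha$ satisfies $\mathrm{lin}_n$ iff there exists a linear order $\prec$ on $[n]$ (irreflexive, transitive, complete) with $\alpha(x_{i,j})=1 \iff i\prec j$ for all $i<j$. Thus the models of $\mathrm{lin}_n$ correspond bijectively to the $n!$ linear orders on $[n]$. A Boolean circuit in negation normal form (NNF) is a rooted directed acyclic graph whose leaves are labelled by $\top$, $\bot$, a variable $x$ or a negated variable $\neg x$, and whose internal nodes are labelled $\wedge$ or $\vee$; it computes a Boolean function in the usual way. It is a DNNF circuit (decomposable NNF) if for every $\wedge$-node, any two of its children root subcircuits with disjoint sets of variables. A circuit expresses a Boolean function if it computes exactly that function on all assignments. The size of a circuit is its number of nodes and edges. -}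

module Defs where

open import Level using (0ℓ)
open import Data.Bool using (Bool; true; false; _∧_; _∨_; not)
open import Data.Nat using (ℕ; zero; suc; _+_)
open import Data.Fin using (Fin; _<_; fromℕ; inject₁)
open import Data.Product using (Σ; Σ-syntax; ∃; ∃-syntax; _×_; _,_; proj₁; proj₂)
open import Data.List using (List; []; _∷_; length; lookup; concatMap; map)
open import Data.List.Membership.Propositional renaming (_∈_ to _∈ₗ_) using ()
open import Data.Vec using (Vec; []; _∷_; _∷ʳ_)
import Data.Vec as Vec
open import Data.Empty using (⊥)
open import Relation.Binary.PropositionalEquality using (_≡_; _≢_)
open import Relation.Binary.Core using (Rel)
open import Relation.Binary.Structures using (IsStrictTotalOrder)
open import Function.Bundles using (_⇔_)

Var : ℕ → Set
Var n = Σ[ p ∈ Fin n × Fin n ] proj₁ p < proj₂ p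

Assignment : ℕ → Set
Assignment n = Var n → Bool

Lin : (n : ℕ) → Assignment n → Set₁
Lin n α = Σ[ _≺_ ∈ Rel (Fin n) 0ℓ ] (IsStrictTotalOrder _≡_ _≺_ ×
          ((i j : Fin n) (i<j : i < j) → (α ((i , j) , i<j) ≡ true) ⇔ (i ≺ j)))

-- NNF circuits as DAGs, nodes listed in topological order.
-- A gate at position k may only have children among positions 0..k-1.

data Gate (V : Set) (k : ℕ) : Set where
  top bot : Gate V k
  lit     : Bool → V → Gate V k
  and or  : List (Fin k) → Gate V k

-- a circuit with k nodes; the root is the last node
data Circ (V : Set) : ℕ → Set where
  []  : Circ V 0
  _▷_ : ∀ {k} → Circ V k → Gate V k → Circ V (suc k)

andL orL : List Bool → Bool
andL []       = true
andL (b ∷ bs) = b ∧ andL bs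
orL []       = false
orL (b ∷ bs) = b ∨ orL bs

gateVal : ∀ {V k} → Gate V k → (V → Bool) → Vec Bool k → Bool
gateVal top        α vs = true
gateVal bot        α vs = false
gateVal (lit true x)  α vs = α x
gateVal (lit false x) α vs = not (α x)
gateVal (and cs)   α vs = andL (map (Vec.lookup vs) cs)
gateVal (or cs)    α vs = orL (map (Vec.lookup vs) cs)

values : ∀ {V k} → Circ V k → (V → Bool) → Vec Bool k
values []      α = []
values (C ▷ g) α = let vs = values C α in vs ∷ʳ gateVal g α vs

eval : ∀ {V m} → Circ V (suc m) → (V → Bool) → Bool
eval {m = m} C α = Vec.lookup (values C α) (fromℕ m)

gateVars : ∀ {V k} → Gate V k → Vec (List V) k → List V
gateVars top       vs = []
gateVars bot       vs = []
gateVars (lit b x) vs = x ∷ []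
gateVars (and cs)  vs = concatMap (Vec.lookup vs) cs
gateVars (or cs)   vs = concatMap (Vec.lookup vs) cs

varsAll : ∀ {V k} → Circ V k → Vec (List V) k
varsAll []      = []
varsAll (C ▷ g) = let vs = varsAll C in vs ∷ʳ gateVars g vs

DecompGate : ∀ {V k} → Gate V k → Vec (List V) k → Set
DecompGate (and cs) vs =
  (p q : Fin (length cs)) → p ≢ q →
  (x : _) → x ∈ₗ Vec.lookup vs (lookup cs p) → x ∈ₗ Vec.lookup vs (lookup cs q) → ⊥
DecompGate _ vs = Data.Unit.⊤
  where import Data.Unit

IsDNNF : ∀ {V k} → Circ V k → Set
IsDNNF []      = Data.Unit.⊤
  where import Data.Unit
IsDNNF (C ▷ g) = IsDNNF C × DecompGate g (varsAll C)

gateEdges : ∀ {V k} → Gate V k → ℕ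
gateEdges (and cs) = length cs
gateEdges (or cs)  = length cs
gateEdges _        = 0

size : ∀ {V k} → Circ V k → ℕ
size []      = 0
size (C ▷ g) = size C + suc (gateEdges g)

ExpressesLin : (n : ℕ) {m : ℕ} → Circ (Var n) (suc m) → Set₁
ExpressesLin n C = (α : Assignment n) → (eval C α ≡ true) ⇔ Lin n α

{-# OPTIONS --safe #-}

-- Bit strings f of length n give linear orders, i preceding j when (f i , i) is lexicographically
-- smaller than (f j , j).  A node φ of a DNNF circuit yields a rectangle of models: the values on
-- vars φ and on the other variables can be chosen independently.  If a triangle i < j < k has edges
-- both in vars φ and outside, then mixing two models must not create a cycle on it, so one of the
-- eight values of (f i , f j , f k) does not occur in the rectangle.  Hence a rectangle with t
-- disjoint such triangles contains at most (7/8)^t of the bit strings.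
-- Call φ full (empty) if vars φ contains all (none) of the edges outside a set of 3t vertices.  A
-- colouring of the edges that has no t disjoint bichromatic triangles is constant outside 3t vertices,
-- so each φ is full, empty or has a good rectangle.  For every model the walk from the root along full
-- nodes satisfied by it ends in a good rectangle, so at most size C rectangles cover all bit strings.

module Submission where

open import Defs
open import Data.Bool using (Bool; true; false; _∧_; _∨_; not; if_then_else_)
open import Data.Bool.Properties using (¬-not; ∧-conicalˡ; ∧-conicalʳ) renaming (_≟_ to _≟ᵇ_)
open import Data.Nat using (ℕ; zero; suc; _+_; _*_; _^_; _≤_; _<_; z≤n; s≤s; _/_; _%_)
open import Data.Nat.DivMod using (m≡m%n+[m/n]*n; m%n<n)
open import Data.Nat.Properties as ℕ using ()
open import Data.Nat.Tactic.RingSolver using (solve-∀)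
open import Data.Fin as Fin using (Fin; zero; suc; toℕ; fromℕ)
open import Data.Fin.Properties as Fin using (any?)
open import Data.List as List using (List; []; _∷_; length; map; _++_; allFin)
open import Data.List.Properties using (length-++; length-map; length-tabulate)
open import Data.List.Membership.Propositional using (_∈_; _∉_; lose)
open import Data.List.Membership.Propositional.Properties using (∈-++⁺ˡ; ∈-++⁺ʳ; ∈-++⁻; ∈-allFin)
open import Data.List.Membership.Setoid.Properties using (index-injective)
import Data.List.Membership.DecPropositional as DecMembership
open import Data.List.Relation.Unary.Any using (Any; here; there; index)
open import Data.List.Relation.Unary.Any.Properties using (lookup-index)
open import Data.List.Relation.Binary.Subset.Propositional using (_⊆_)
open import Data.Vec as Vec using (Vec; []; _∷_; lookup; _[_]≔_; _∷ʳ_)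
open import Data.Vec.Properties using (lookup∘update; lookup∘update′; lookup-map; map-∷ʳ)
open import Data.Vec.Relation.Unary.All as All using (All; []; _∷_)
open import Data.Vec.Relation.Unary.All.Properties using (lookup⁺)
open import Data.Product using (Σ-syntax; ∃; ∃-syntax; _×_; _,_; proj₁; proj₂)
open import Data.Product.Properties using (≡-dec)
open import Data.Sum using (_⊎_; inj₁; inj₂; [_,_]′)
open import Data.Unit using (tt)
open import Function using (_∘_; flip; id)
open import Function.Bundles using (mk⇔; Equivalence)
open import Relation.Nullary using (Dec; yes; no; does; ¬_; contradiction)
open import Relation.Nullary.Decidable using (_×-dec_; ¬?; map′; decidable-stable; dec-true; dec-false)
open import Relation.Binary.Definitions using (DecidableEquality; Trichotomous; tri<; tri≈; tri>)
open import Relation.Binary.Structures using (IsStrictTotalOrder)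
open import Relation.Binary.Structures.Biased using (isStrictTotalOrderᶜ)
open import Relation.Binary.PropositionalEquality

private variable
  n t : ℕ

-- Counting bit strings

cubeSum : (Vec Bool n → ℕ) → ℕ
cubeSum {zero}  g = g []
cubeSum {suc n} g = cubeSum (λ f → g (false ∷ f)) + cubeSum (λ f → g (true ∷ f))

cubeSum-cong : {g h : Vec Bool n → ℕ} → g ≗ h → cubeSum g ≡ cubeSum h
cubeSum-cong {zero}  eq = eq []
cubeSum-cong {suc n} eq = cong₂ _+_ (cubeSum-cong (eq ∘ (false ∷_))) (cubeSum-cong (eq ∘ (true ∷_)))

cubeSum-mono : {g h : Vec Bool n → ℕ} → (∀ f → g f ≤ h f) → cubeSum g ≤ cubeSum h
cubeSum-mono {zero}  le = le []
cubeSum-mono {suc n} le = ℕ.+-mono-≤ (cubeSum-mono (le ∘ (false ∷_))) (cubeSum-mono (le ∘ (true ∷_)))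

cubeSum-+ : (g h : Vec Bool n → ℕ) → cubeSum (λ f → g f + h f) ≡ cubeSum g + cubeSum h
cubeSum-+ {zero}  g h = refl
cubeSum-+ {suc n} g h = trans
  (cong₂ _+_ (cubeSum-+ (g ∘ (false ∷_)) (h ∘ (false ∷_))) (cubeSum-+ (g ∘ (true ∷_)) (h ∘ (true ∷_))))
  (interchange (cubeSum (g ∘ (false ∷_))) _ (cubeSum (g ∘ (true ∷_))) _)
  where
  interchange : ∀ a b c d → (a + b) + (c + d) ≡ (a + c) + (b + d)
  interchange = solve-∀

cubeSum-* : ∀ a (g : Vec Bool n → ℕ) → cubeSum (λ f → a * g f) ≡ a * cubeSum g
cubeSum-* {zero}  a g = refl
cubeSum-* {suc n} a g = trans
  (cong₂ _+_ (cubeSum-* a (g ∘ (false ∷_))) (cubeSum-* a (g ∘ (true ∷_))))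
  (sym (ℕ.*-distribˡ-+ a _ _))

cubeSum-const : ∀ a → cubeSum {n} (λ _ → a) ≡ 2 ^ n * a
cubeSum-const {zero}  a = sym (ℕ.+-identityʳ a)
cubeSum-const {suc n} a rewrite cubeSum-const {n} a = double (2 ^ n) a
  where
  double : ∀ p a → p * a + p * a ≡ 2 * p * a
  double = solve-∀

resample : Fin n → (Vec Bool n → ℕ) → Vec Bool n → ℕ
resample i g f = g (f [ i ]≔ false) + g (f [ i ]≔ true)

-- Coordinate `i` of `f` remains as a dummy, so every bit string is reached twice, once from each
-- value of the dummy.
cubeSum-resample : ∀ (i : Fin n) g → cubeSum (resample i g) ≡ 2 * cubeSum g
cubeSum-resample {suc n} zero g
  rewrite cubeSum-+ (λ f → g (false ∷ f)) (λ f → g (true ∷ f)) =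
  cong (cubeSum {suc n} g +_) (sym (ℕ.+-identityʳ (cubeSum {suc n} g)))
cubeSum-resample (suc i) g = trans
  (cong₂ _+_ (cubeSum-resample i (g ∘ (false ∷_))) (cubeSum-resample i (g ∘ (true ∷_))))
  (sym (ℕ.*-distribˡ-+ 2 (cubeSum (g ∘ (false ∷_))) _))

indicator : Bool → ℕ
indicator b = if b then 1 else 0

-- Independent clauses on disjoint triangles

Pattern : Set
Pattern = Bool × Bool × Bool

matches : Pattern → Pattern → Bool
matches (a , b , c) (p , q , r) = does (a ≟ᵇ p) ∧ does (b ≟ᵇ q) ∧ does (c ≟ᵇ r)

matches⇒≡ : ∀ p q → matches p q ≡ true → p ≡ q
matches⇒≡ (a , b , c) (p , q , r) _ with a ≟ᵇ p | b ≟ᵇ q | c ≟ᵇ r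
... | yes refl | yes refl | yes refl = refl

record Triangle (n : ℕ) : Set where
  constructor triangle
  field
    {i j k} : Fin n
    i<j     : i Fin.< j
    j<k     : j Fin.< k

  i<k : i Fin.< k
  i<k = ℕ.<-trans i<j j<k

  ij jk ik : Var n
  ij = (i , j) , i<j
  jk = (j , k) , j<k
  ik = (i , k) , i<k

  corners : List (Fin n)
  corners = i ∷ j ∷ k ∷ []

  restrict : Vec Bool n → Pattern
  restrict f = lookup f i , lookup f j , lookup f k

Outside : List (Fin n) → Triangle n → Set
Outside D T = i ∉ D × j ∉ D × k ∉ D
  where open Triangle T

-- `D` collects the vertices already used. Since the tail must avoid the corners of `T` as well, the
-- triangles are pairwise disjoint and the clauses read disjoint sets of coordinates.
data Clauses {n} (D : List (Fin n)) : ℕ → Set where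
  []     : Clauses D 0
  clause : (T : Triangle n) → Outside D T → Pattern →
           Clauses (Triangle.corners T ++ D) t → Clauses D (suc t)

satisfies : {D : List (Fin n)} → Clauses D t → Vec Bool n → Bool
satisfies []                f = true
satisfies (clause T _ p cs) f = not (matches (Triangle.restrict T f) p) ∧ satisfies cs f

-- All triangles of `cs` lie outside `D`, so no clause reads coordinate `a`.
satisfies-update : {D : List (Fin n)} (cs : Clauses D t) {a : Fin n} → a ∈ D →
                   ∀ b f → satisfies cs (f [ a ]≔ b) ≡ satisfies cs f
satisfies-update []                              a∈D b f = refl
satisfies-update (clause T (i∉ , j∉ , k∉) p cs) {a} a∈D b f
  rewrite lookup∘update′ (λ eq → i∉ (subst (_∈ _) (sym eq) a∈D)) f b
        | lookup∘update′ (λ eq → j∉ (subst (_∈ _) (sym eq) a∈D)) f b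
        | lookup∘update′ (λ eq → k∉ (subst (_∈ _) (sym eq) a∈D)) f b
        | satisfies-update cs (there (there (there a∈D))) b f = refl

-- Exactly one of the eight triples equals `p`.
sevenOfEight : ∀ p s → let c = λ x y z → indicator (not (matches (x , y , z) p) ∧ s) in
  ((c false false false + c false false true) + (c false true false + c false true true)) +
  ((c true  false false + c true  false true) + (c true  true  false + c true  true  true))
  ≡ 7 * indicator s
sevenOfEight (false , false , false) false = refl
sevenOfEight (false , false , true)  false = refl
sevenOfEight (false , true  , false) false = refl
sevenOfEight (false , true  , true)  false = refl
sevenOfEight (true  , false , false) false = refl
sevenOfEight (true  , false , true)  false = refl
sevenOfEight (true  , true  , false) false = refl
sevenOfEight (true  , true  , true)  false = refl
sevenOfEight (false , false , false) true = refl
sevenOfEight (false , false , true)  true = refl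
sevenOfEight (false , true  , false) true = refl
sevenOfEight (false , true  , true)  true = refl
sevenOfEight (true  , false , false) true = refl
sevenOfEight (true  , false , true)  true = refl
sevenOfEight (true  , true  , false) true = refl
sevenOfEight (true  , true  , true)  true = refl

module _ {D : List (Fin n)} (T : Triangle n) (out : Outside D T) (p : Pattern)
         (cs : Clauses (Triangle.corners T ++ D) t) where
  open Triangle T

  private
    g : Vec Bool n → ℕ
    g = indicator ∘ satisfies (clause {D = D} T out p cs)

  satisfies-updates : ∀ f x y z → g (f [ i ]≔ x [ j ]≔ y [ k ]≔ z)
                      ≡ indicator (not (matches (x , y , z) p) ∧ satisfies cs f)
  satisfies-updates f x y z
    rewrite lookup∘update′ (ℕ.<⇒≢ i<k ∘ cong Fin.toℕ) (f [ i ]≔ x [ j ]≔ y) z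
          | lookup∘update′ (ℕ.<⇒≢ i<j ∘ cong Fin.toℕ) (f [ i ]≔ x) y
          | lookup∘update i f x
          | lookup∘update′ (ℕ.<⇒≢ j<k ∘ cong Fin.toℕ) (f [ i ]≔ x [ j ]≔ y) z
          | lookup∘update j (f [ i ]≔ x) y
          | lookup∘update k (f [ i ]≔ x [ j ]≔ y) z
          | satisfies-update cs (there (there (here refl))) z (f [ i ]≔ x [ j ]≔ y)
          | satisfies-update cs (there (here refl)) y (f [ i ]≔ x)
          | satisfies-update cs (here refl) x f = refl

  -- Resampling the three corners averages the head clause, which keeps seven of the eight patterns,
  -- while `cs` does not read these corners. The clause thus costs a factor of exactly 7/8, written
  -- with the denominator cleared.
  cubeSum-clause : 8 * cubeSum g ≡ 7 * cubeSum (indicator ∘ satisfies cs)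
  cubeSum-clause = begin
    8 * cubeSum g                                      ≡⟨ eight (cubeSum g) ⟩
    2 * (2 * (2 * cubeSum g))                          ≡⟨ cong (λ x → 2 * (2 * x)) (cubeSum-resample k g) ⟨
    2 * (2 * cubeSum (resample k g))                   ≡⟨ cong (2 *_) (cubeSum-resample j (resample k g)) ⟨
    2 * cubeSum (resample j (resample k g))            ≡⟨ cubeSum-resample i (resample j (resample k g)) ⟨
    cubeSum (resample i (resample j (resample k g)))   ≡⟨ cubeSum-cong pointwise ⟩
    cubeSum (λ f → 7 * indicator (satisfies cs f))     ≡⟨ cubeSum-* 7 (indicator ∘ satisfies cs) ⟩
    7 * cubeSum (indicator ∘ satisfies cs)             ∎
    where
    open ≡-Reasoning
    eight : ∀ x → 8 * x ≡ 2 * (2 * (2 * x))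
    eight = solve-∀
    pointwise : ∀ f → resample i (resample j (resample k g)) f ≡ 7 * indicator (satisfies cs f)
    pointwise f = trans
      (cong₂ _+_
        (cong₂ _+_ (cong₂ _+_ (satisfies-updates f _ _ _) (satisfies-updates f _ _ _))
                   (cong₂ _+_ (satisfies-updates f _ _ _) (satisfies-updates f _ _ _)))
        (cong₂ _+_ (cong₂ _+_ (satisfies-updates f _ _ _) (satisfies-updates f _ _ _))
                   (cong₂ _+_ (satisfies-updates f _ _ _) (satisfies-updates f _ _ _))))
      (sevenOfEight p (satisfies cs f))

cubeSum-satisfies : {D : List (Fin n)} (cs : Clauses D t) →
                    8 ^ t * cubeSum (indicator ∘ satisfies cs) ≡ 7 ^ t * 2 ^ n
cubeSum-satisfies {n} [] rewrite cubeSum-const {n} 1 = cong (_+ 0) (ℕ.*-identityʳ (2 ^ n))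
cubeSum-satisfies {n} {suc t} (clause T out p cs) = begin
  8 * 8 ^ t * s                             ≡⟨ swap 8 (8 ^ t) s ⟩
  8 ^ t * (8 * s)                           ≡⟨ cong (8 ^ t *_) (cubeSum-clause T out p cs) ⟩
  8 ^ t * (7 * s′)                          ≡⟨ trans (sym (swap 7 (8 ^ t) s′)) (ℕ.*-assoc 7 (8 ^ t) s′) ⟩
  7 * (8 ^ t * s′)                          ≡⟨ cong (7 *_) (cubeSum-satisfies cs) ⟩
  7 * (7 ^ t * 2 ^ n)                       ≡⟨ ℕ.*-assoc 7 (7 ^ t) (2 ^ n) ⟨
  7 * 7 ^ t * 2 ^ n                         ∎
  where
  open ≡-Reasoning
  s s′ : ℕ
  s  = cubeSum (indicator ∘ satisfies (clause T out p cs))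
  s′ = cubeSum (indicator ∘ satisfies cs)
  swap : ∀ a x y → a * x * y ≡ x * (a * y)
  swap = solve-∀

-- Union bound: `count` counts the sets containing `f`, so it is at least 1 everywhere, and each set
-- has at most b/a members.
cover-bound : ∀ {A : Set} (G : A → Vec Bool n → Bool) (rs : List A) →
              (∀ f → Any (λ r → G r f ≡ true) rs) →
              ∀ a b → (∀ r → a * cubeSum (indicator ∘ G r) ≤ b) → a * 2 ^ n ≤ length rs * b
cover-bound {n} {A} G rs cover a b bound = begin
  a * 2 ^ n                    ≡⟨ cong (a *_) (trans (cubeSum-const {n} 1) (ℕ.*-identityʳ _)) ⟨
  a * cubeSum {n} (λ _ → 1)    ≤⟨ ℕ.*-monoʳ-≤ a (cubeSum-mono (λ f → covered f rs (cover f))) ⟩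
  a * cubeSum (count rs)       ≤⟨ go rs ⟩
  length rs * b                ∎
  where
  open ℕ.≤-Reasoning
  count : List A → Vec Bool n → ℕ
  count []       f = 0
  count (r ∷ rs) f = indicator (G r f) + count rs f
  covered : ∀ f rs → Any (λ r → G r f ≡ true) rs → 1 ≤ count rs f
  covered f (r ∷ rs) (here eq) rewrite eq = s≤s z≤n
  covered f (r ∷ rs) (there p) = ℕ.≤-trans (covered f rs p) (ℕ.m≤n+m _ _)
  go : ∀ rs → a * cubeSum (count rs) ≤ length rs * b
  go [] rewrite cubeSum-const {n} 0 | ℕ.*-zeroʳ (2 ^ n) = ℕ.≤-reflexive (ℕ.*-zeroʳ a)
  go (r ∷ rs) rewrite cubeSum-+ (indicator ∘ G r) (count rs)
                    | ℕ.*-distribˡ-+ a (cubeSum (indicator ∘ G r)) (cubeSum (count rs)) =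
    ℕ.+-mono-≤ (bound r) (go rs)

-- Exhaustive search; it justifies the case distinctions on whether a set of bit strings is
-- inhabited.
anyVec? : (P : Vec Bool n → Bool) → Dec (∃[ f ] P f ≡ true)
anyVec? {zero} P with P [] in eq
... | true  = yes ([] , eq)
... | false = no λ { ([] , eq′) → contradiction (trans (sym eq) eq′) λ () }
anyVec? {suc n} P with anyVec? (P ∘ (false ∷_)) | anyVec? (P ∘ (true ∷_))
... | yes (f , e) | _           = yes (false ∷ f , e)
... | no _        | yes (f , e) = yes (true ∷ f , e)
... | no ¬p       | no ¬q       = no λ { (false ∷ f , e) → ¬p (f , e) ; (true ∷ f , e) → ¬q (f , e) }

-- Triangles in edge colourings

open module FinMembership {n} = DecMembership (Fin._≟_ {n}) using (_∈?_)

-- Pigeonhole: if every vertex were in `D`, the positions in `D` would inject `Fin n` into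
-- `Fin (length D)`.
fresh : (D : List (Fin n)) → length D < n → ∃[ i ] i ∉ D
fresh {n} D D<n = Fin.¬∀⟶∃¬ n (_∈ D) (_∈? D) λ every → ℕ.<⇒≱ D<n
  (Fin.injective⇒≤ {f = λ i → index (every i)}
    λ {i} {j} → index-injective (setoid (Fin n)) (every i) (every j))

insertCorner : ∀ {D : List (Fin n)} {a b} c → a Fin.< b → a ∉ D → b ∉ D → c ∉ D →
               a ≢ c → b ≢ c → ∃ (Outside D)
insertCorner {a = a} {b} c a<b a∉ b∉ c∉ a≢c b≢c with Fin.<-cmp a c | Fin.<-cmp b c
... | _            | tri< b<c _ _ = triangle a<b b<c , a∉ , b∉ , c∉
... | tri< a<c _ _ | tri> _ _ c<b = triangle a<c c<b , a∉ , c∉ , b∉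
... | tri> _ _ c<a | tri> _ _ _   = triangle c<a a<b , c∉ , a∉ , b∉
... | tri≈ _ a≡c _ | _            = contradiction a≡c a≢c
... | _            | tri≈ _ b≡c _ = contradiction b≡c b≢c

abstract
  freshTriangle : (D : List (Fin n)) → 2 + length D < n → ∃ (Outside D)
  freshTriangle D lt with fresh D (ℕ.<-trans (ℕ.n<1+n _) (ℕ.<-trans (ℕ.n<1+n _) lt))
  ... | a , a∉ with fresh (a ∷ D) (ℕ.<-trans (ℕ.n<1+n _) lt)
  ... | b , b∉ with fresh (b ∷ a ∷ D) lt
  ... | c , c∉ with Fin.<-cmp a b
  ... | tri< a<b _ _ = insertCorner c a<b a∉ (b∉ ∘ there) (c∉ ∘ there ∘ there)
                         (c∉ ∘ there ∘ here ∘ sym) (c∉ ∘ here ∘ sym)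
  ... | tri≈ _ a≡b _ = contradiction (here (sym a≡b)) b∉
  ... | tri> _ _ b<a = insertCorner c b<a (b∉ ∘ there) a∉ (c∉ ∘ there ∘ there)
                         (c∉ ∘ here ∘ sym) (c∉ ∘ there ∘ here ∘ sym)

Outside-++⁻ˡ : ∀ (D : List (Fin n)) {E} T → Outside (D ++ E) T → Outside D T
Outside-++⁻ˡ D _ (i∉ , j∉ , k∉) = i∉ ∘ ∈-++⁺ˡ , j∉ ∘ ∈-++⁺ˡ , k∉ ∘ ∈-++⁺ˡ

Outside-++⁻ʳ : ∀ (D : List (Fin n)) {E} T → Outside (D ++ E) T → Outside E T
Outside-++⁻ʳ D _ (i∉ , j∉ , k∉) = i∉ ∘ ∈-++⁺ʳ D , j∉ ∘ ∈-++⁺ʳ D , k∉ ∘ ∈-++⁺ʳ D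

module Colouring {n} (χ : Var n → Bool) where

  Monochromatic : Triangle n → Set
  Monochromatic T = χ ij ≡ χ ik × χ jk ≡ χ ik
    where open Triangle T

  -- Keeps track of used vertices exactly as `Clauses` does, so that a packing turns into clauses
  -- triangle by triangle.
  data Packing (D : List (Fin n)) : ℕ → Set where
    []  : Packing D 0
    add : ∀ {t} (T : Triangle n) → Outside D T → ¬ Monochromatic T →
          Packing (Triangle.corners T ++ D) t → Packing D (suc t)

  Homogeneous : Bool → List (Fin n) → Set
  Homogeneous b D = ∀ {i j} (i<j : i Fin.< j) → i ∉ D → j ∉ D → χ ((i , j) , i<j) ≡ b

  -- `i < j` has at most one proof, so testing `P` on that proof settles the existential.
  Σ-<-dec : ∀ {i j : Fin n} {P : i Fin.< j → Set} → (∀ p → Dec (P p)) → Dec (∃ P)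
  Σ-<-dec {i} {j} {P} P? with i Fin.<? j
  ... | no  i≮j = no (i≮j ∘ proj₁)
  ... | yes i<j = map′ (i<j ,_)
    (λ (p , Pp) → subst P (Fin.<-irrelevant p i<j) Pp) (P? i<j)

  bichromatic? : ∀ D → Dec (∃[ T ] Outside D T × ¬ Monochromatic T)
  bichromatic? D = map′
    (λ (i , j , k , p , q , r) → triangle p q , r)
    (λ (triangle {i} {j} {k} p q , r) → i , j , k , p , q , r)
    (any? λ i → any? λ j → any? λ k → Σ-<-dec λ p → Σ-<-dec λ q →
      (¬? (i ∈? D) ×-dec ¬? (j ∈? D) ×-dec ¬? (k ∈? D)) ×-dec
      ¬? ((_ ≟ᵇ _) ×-dec (_ ≟ᵇ _)))

  module _ {D : List (Fin n)} (mono : ∀ T → Outside D T → Monochromatic T) where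

    -- Both edges lie in the triangle on `i`, `j`, `l`, whose smallest corner is `i`.
    sameSource : ∀ {i j l} (p : i Fin.< j) (q : i Fin.< l) → i ∉ D → j ∉ D → l ∉ D →
                 χ ((i , j) , p) ≡ χ ((i , l) , q)
    sameSource {i} {j} {l} p q i∉ j∉ l∉ with Fin.<-cmp j l
    ... | tri< j<l _ _ = trans (proj₁ (mono (triangle p j<l) (i∉ , j∉ , l∉)))
                               (cong (λ r → χ ((i , l) , r)) (Fin.<-irrelevant _ q))
    ... | tri≈ _ refl _ = cong (λ r → χ ((i , l) , r)) (Fin.<-irrelevant p q)
    ... | tri> _ _ l<j = sym (trans (proj₁ (mono (triangle q l<j) (i∉ , l∉ , j∉)))
                               (cong (λ r → χ ((i , j) , r)) (Fin.<-irrelevant _ p)))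

    -- Both edges are compared with the edge from `i` to `l`: the first shares its source, the
    -- second lies with it in the triangle `i < k < l`.
    smallerSource : ∀ {i j k l} → i Fin.< k → (p : i Fin.< j) (q : k Fin.< l) →
                    i ∉ D → j ∉ D → k ∉ D → l ∉ D → χ ((i , j) , p) ≡ χ ((k , l) , q)
    smallerSource i<k p q i∉ j∉ k∉ l∉ = trans (sameSource p _ i∉ j∉ l∉)
      (sym (proj₂ (mono (triangle i<k q) (i∉ , k∉ , l∉))))

    sameColour : ∀ {i j k l} (p : i Fin.< j) (q : k Fin.< l) →
                 i ∉ D → j ∉ D → k ∉ D → l ∉ D → χ ((i , j) , p) ≡ χ ((k , l) , q)
    sameColour {i} {k = k} p q i∉ j∉ k∉ l∉ with Fin.<-cmp i k
    ... | tri< i<k _ _  = smallerSource i<k p q i∉ j∉ k∉ l∉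
    ... | tri≈ _ refl _ = sameSource p q i∉ j∉ l∉
    ... | tri> _ _ k<i  = sym (smallerSource k<i q p k∉ l∉ i∉ j∉)

  -- Greedy choice: take any bichromatic triangle outside the used vertices and add its three
  -- corners to them. When none is left, the used vertices form the exceptional set `E`.
  pack : ∀ t D → Packing D t ⊎
         ∃[ E ] length E ≤ 3 * t + length D × (∀ T → Outside E T → Monochromatic T)
  pack zero    D = inj₁ []
  pack (suc t) D with bichromatic? D
  ... | no none = inj₂ (D , ℕ.m≤n+m _ _ , λ T out →
          decidable-stable ((_ ≟ᵇ _) ×-dec (_ ≟ᵇ _)) λ bi → none (T , out , bi))
  ... | yes (T , out , bi) with pack t (Triangle.corners T ++ D)
  ...   | inj₁ P = inj₁ (add T out bi P)
  ...   | inj₂ (E , E≤ , mono) = inj₂ (E , ℕ.≤-trans E≤ (ℕ.≤-reflexive (shift t (length D))) , mono)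
    where
    shift : ∀ t d → 3 * t + (3 + d) ≡ 3 * suc t + d
    shift = solve-∀

  abstract
    dichotomy : ∀ t → 2 + 3 * t < n →
                Packing [] t ⊎ ∃[ b ] ∃[ D ] length D ≤ 3 * t × Homogeneous b D
    dichotomy t lt with pack t []
    ... | inj₁ P = inj₁ P
    ... | inj₂ (D , D≤ , mono) with ℕ.≤-trans D≤ (ℕ.≤-reflexive (ℕ.+-identityʳ _))
    ... | D≤3t with freshTriangle D (ℕ.≤-<-trans (ℕ.+-monoʳ-≤ 2 D≤3t) lt)
    -- An edge of a fresh triangle serves as reference: its colour is the common colour of all edges
    -- outside `D`.
    ... | T , i∉ , j∉ , k∉ = inj₂ (χ ij , D , D≤3t , λ p i∉′ j∉′ → sameColour mono p i<j i∉′ j∉′ i∉ j∉)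
      where open Triangle T

-- Linear orders and rectangles

-- As `i < j`, the lexicographic comparison puts `i` first unless the bit of `i` is true and that of
-- `j` is false.
order : Vec Bool n → Assignment n
order f ((i , j) , _) = not (lookup f i) ∨ lookup f j

module _ (f : Vec Bool n) where

  -- Encodes the pair of bit and index as one number: the shift by `n` moves the vertices with bit
  -- true behind all those with bit false.
  rank : Fin n → ℕ
  rank i = (if lookup f i then n else 0) + toℕ i

  rank-injective : ∀ {i j} → rank i ≡ rank j → i ≡ j
  rank-injective {i} {j} eq with lookup f i | lookup f j
  ... | false | false = Fin.toℕ-injective eq
  ... | true  | true  = Fin.toℕ-injective (ℕ.+-cancelˡ-≡ n _ _ eq)
  ... | false | true  = contradiction (Fin.toℕ<n i) (ℕ.≤⇒≯ (subst (n ≤_) (sym eq) (ℕ.m≤m+n n _)))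
  ... | true  | false = contradiction (Fin.toℕ<n j) (ℕ.≤⇒≯ (subst (n ≤_) eq (ℕ.m≤m+n n _)))

  order-Lin : Lin n (order f)
  order-Lin = (λ i j → rank i < rank j) ,
    isStrictTotalOrderᶜ record
      { isEquivalence = isEquivalence
      ; trans         = ℕ.<-trans
      ; compare       = compare
      } ,
    λ i j i<j → mk⇔ (to i j i<j) (from i j i<j)
    where
    compare : Trichotomous _≡_ (λ i j → rank i < rank j)
    compare i j with ℕ.<-cmp (rank i) (rank j)
    ... | tri< a b c = tri< a (b ∘ cong rank) c
    ... | tri≈ a b c = tri≈ a (rank-injective b) c
    ... | tri> a b c = tri> a (b ∘ cong rank) c
    to : ∀ i j (i<j : i Fin.< j) → order f ((i , j) , i<j) ≡ true → rank i < rank j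
    to i j i<j eq with lookup f i | lookup f j
    ... | false | false = i<j
    ... | true  | true  = ℕ.+-monoʳ-< n i<j
    ... | false | true  = ℕ.<-≤-trans (Fin.toℕ<n i) (ℕ.m≤m+n n _)
    from : ∀ i j (i<j : i Fin.< j) → rank i < rank j → order f ((i , j) , i<j) ≡ true
    from i j i<j lt with lookup f i | lookup f j
    ... | false | _     = refl
    ... | true  | true  = refl
    ... | true  | false = contradiction (ℕ.<-trans (ℕ.≤-<-trans (ℕ.m≤m+n n _) lt) (Fin.toℕ<n j)) (ℕ.<-irrefl refl)

-- Cycles in mixed orders

Cyclic : Assignment n → Triangle n → Set
Cyclic α T = α ij ≡ true × α jk ≡ true × α ik ≡ false
  where open Triangle T

Lin⇒¬Cyclic : ∀ {α : Assignment n} → Lin n α → ∀ T → ¬ Cyclic α T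
Lin⇒¬Cyclic (_≺_ , isOrder , iff) T (ij≡t , jk≡t , ik≡f) = false≢true (trans (sym ik≡f)
  (Equivalence.from (iff _ _ i<k) (IsStrictTotalOrder.trans isOrder
    (Equivalence.to (iff _ _ i<j) ij≡t) (Equivalence.to (iff _ _ j<k) jk≡t))))
  where
  open Triangle T
  false≢true : false ≢ true
  false≢true ()

mix : (V : Var n → Bool) → Assignment n → Assignment n → Assignment n
mix χ β α x = if χ x then β x else α x

-- An order restricting to this pattern and one restricting to (false , false , false) combine to a cycle on T.
conflict : (χ : Var n → Bool) → Triangle n → Pattern
conflict χ T = if does (χ ij ≟ᵇ χ ik) then (true , true , false) else (true , false , false)
  where open Triangle T

-- `f` makes all three edges true and `g` makes `ik` false. The conflict pattern is chosen so that,
-- of `ij` and `jk`, `g` makes false only one whose colour differs from that of `ik`. Taking the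
-- colour class of `ik` from `g` and the other from `f` closes the cycle; the colour of `ik` decides
-- which of the two mixes this is.
combine-cyclic : ∀ (χ : Var n → Bool) T → ¬ Colouring.Monochromatic χ T →
  ∀ f g → Triangle.restrict T f ≡ (false , false , false) → Triangle.restrict T g ≡ conflict χ T →
  Cyclic (mix χ (order f) (order g)) T ⊎ Cyclic (mix χ (order g) (order f)) T
combine-cyclic χ T bi f g fT gT with lookup f (Triangle.i T) | lookup f (Triangle.j T) | lookup f (Triangle.k T)
  | lookup g (Triangle.i T) | lookup g (Triangle.j T) | lookup g (Triangle.k T)
  | χ (Triangle.ij T) | χ (Triangle.jk T) | χ (Triangle.ik T)
combine-cyclic χ T bi f g refl refl | _ | _ | _ | _ | _ | _ | false | false | false = contradiction (refl , refl) bi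
combine-cyclic χ T bi f g refl refl | _ | _ | _ | _ | _ | _ | false | false | true  = inj₂ (refl , refl , refl)
combine-cyclic χ T bi f g refl refl | _ | _ | _ | _ | _ | _ | false | true  | false = inj₁ (refl , refl , refl)
combine-cyclic χ T bi f g refl refl | _ | _ | _ | _ | _ | _ | false | true  | true  = inj₂ (refl , refl , refl)
combine-cyclic χ T bi f g refl refl | _ | _ | _ | _ | _ | _ | true  | false | false = inj₁ (refl , refl , refl)
combine-cyclic χ T bi f g refl refl | _ | _ | _ | _ | _ | _ | true  | false | true  = inj₂ (refl , refl , refl)
combine-cyclic χ T bi f g refl refl | _ | _ | _ | _ | _ | _ | true  | true  | false = inj₁ (refl , refl , refl)
combine-cyclic χ T bi f g refl refl | _ | _ | _ | _ | _ | _ | true  | true  | true  = contradiction (refl , refl) bi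

-- On each triangle, either no member of `R` restricts to (false , false , false), and this pattern
-- is forbidden, or some member `f` does, and then no member can have the conflict pattern, since
-- mixing it with `f` would give a cycle.
clauses : ∀ (χ : Var n → Bool) (R : Vec Bool n → Bool) →
  (∀ f g → R f ≡ true → R g ≡ true → ∀ T → ¬ Cyclic (mix χ (order f) (order g)) T) →
  ∀ {D} → Colouring.Packing χ D t → Σ[ cs ∈ Clauses D t ] (∀ f → R f ≡ true → satisfies cs f ≡ true)
clauses χ R rect Colouring.[] = [] , λ _ _ → refl
clauses χ R rect (Colouring.add T out bi P) with clauses χ R rect P
  | anyVec? (λ f → R f ∧ matches (Triangle.restrict T f) (false , false , false))
... | cs , sat | no none = clause T out (false , false , false) cs , λ f Rf →
  cong₂ _∧_ (cong not (¬-not λ m → none (f , cong₂ _∧_ Rf m))) (sat f Rf)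
... | cs , sat | yes (f , both) = clause T out (conflict χ T) cs , λ g Rg →
  cong₂ _∧_ (cong not (¬-not λ m →
    [ rect f g Rf Rg T , rect g f Rg Rf T ]′
      (combine-cyclic χ T bi f g (matches⇒≡ _ _ (∧-conicalʳ (R f) _ both)) (matches⇒≡ _ _ m))))
    (sat g Rg)
  where
  Rf : R f ≡ true
  Rf = ∧-conicalˡ (R f) _ both

rectangle-bound : ∀ (χ : Var n → Bool) (R : Vec Bool n → Bool) →
  (∀ f g → R f ≡ true → R g ≡ true → ∀ T → ¬ Cyclic (mix χ (order f) (order g)) T) →
  Colouring.Packing χ [] t → 8 ^ t * cubeSum (indicator ∘ R) ≤ 7 ^ t * 2 ^ n
rectangle-bound {n} {t} χ R rect P with clauses χ R rect P
... | cs , sat = ℕ.≤-trans (ℕ.*-monoʳ-≤ (8 ^ t) (cubeSum-mono pointwise))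
                           (ℕ.≤-reflexive (cubeSum-satisfies cs))
  where
  pointwise : ∀ f → indicator (R f) ≤ indicator (satisfies cs f)
  pointwise f with R f in eq
  ... | false = z≤n
  ... | true rewrite sat f eq = ℕ.≤-refl

-- Unfolding circuits into formulas

infixr 6 _∧ᶠ_
infixr 5 _∨ᶠ_

data Formula (V : Set) : Set where
  ⊤ᶠ ⊥ᶠ     : Formula V
  literal   : Bool → V → Formula V
  _∧ᶠ_ _∨ᶠ_ : Formula V → Formula V → Formula V

module _ {V : Set} where

  private variable
    k : ℕ
    φ ψ : Formula V
    L M : List (Formula V)

  ⟦_⟧ : Formula V → (V → Bool) → Bool
  ⟦ ⊤ᶠ ⟧              α = true
  ⟦ ⊥ᶠ ⟧              α = false
  ⟦ literal true x ⟧  α = α x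
  ⟦ literal false x ⟧ α = not (α x)
  ⟦ φ ∧ᶠ ψ ⟧          α = ⟦ φ ⟧ α ∧ ⟦ ψ ⟧ α
  ⟦ φ ∨ᶠ ψ ⟧          α = ⟦ φ ⟧ α ∨ ⟦ ψ ⟧ α

  vars : Formula V → List V
  vars ⊤ᶠ            = []
  vars ⊥ᶠ            = []
  vars (literal _ x) = x ∷ []
  vars (φ ∧ᶠ ψ)      = vars φ ++ vars ψ
  vars (φ ∨ᶠ ψ)      = vars φ ++ vars ψ

  ⟦⟧-local : ∀ φ {α β : V → Bool} → (∀ {x} → x ∈ vars φ → α x ≡ β x) → ⟦ φ ⟧ α ≡ ⟦ φ ⟧ β
  ⟦⟧-local ⊤ᶠ                agree = refl
  ⟦⟧-local ⊥ᶠ                agree = refl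
  ⟦⟧-local (literal true x)  agree = agree (here refl)
  ⟦⟧-local (literal false x) agree = cong not (agree (here refl))
  ⟦⟧-local (φ ∧ᶠ ψ) agree =
    cong₂ _∧_ (⟦⟧-local φ (agree ∘ ∈-++⁺ˡ)) (⟦⟧-local ψ (agree ∘ ∈-++⁺ʳ (vars φ)))
  ⟦⟧-local (φ ∨ᶠ ψ) agree =
    cong₂ _∨_ (⟦⟧-local φ (agree ∘ ∈-++⁺ˡ)) (⟦⟧-local ψ (agree ∘ ∈-++⁺ʳ (vars φ)))

  -- L bounds the number of distinct subformulas: the unfolding of a circuit may be exponentially large.
  data Decomposable (L : List (Formula V)) : Formula V → Set where
    top  : ⊤ᶠ ∈ L → Decomposable L ⊤ᶠ
    bot  : ⊥ᶠ ∈ L → Decomposable L ⊥ᶠ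
    lit  : ∀ {b x} → literal b x ∈ L → Decomposable L (literal b x)
    conj : φ ∧ᶠ ψ ∈ L → Decomposable L φ → Decomposable L ψ →
           (∀ {x} → x ∈ vars φ → x ∉ vars ψ) → Decomposable L (φ ∧ᶠ ψ)
    disj : φ ∨ᶠ ψ ∈ L → Decomposable L φ → Decomposable L ψ → Decomposable L (φ ∨ᶠ ψ)

  Decomposable⇒∈ : Decomposable L φ → φ ∈ L
  Decomposable⇒∈ (top m)        = m
  Decomposable⇒∈ (bot m)        = m
  Decomposable⇒∈ (lit m)        = m
  Decomposable⇒∈ (conj m _ _ _) = m
  Decomposable⇒∈ (disj m _ _)   = m

  Decomposable-⊆ : L ⊆ M → Decomposable L φ → Decomposable M φ
  Decomposable-⊆ L⊆M (top m)          = top (L⊆M m)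
  Decomposable-⊆ L⊆M (bot m)          = bot (L⊆M m)
  Decomposable-⊆ L⊆M (lit m)          = lit (L⊆M m)
  Decomposable-⊆ L⊆M (conj m d e dis) = conj (L⊆M m) (Decomposable-⊆ L⊆M d) (Decomposable-⊆ L⊆M e) dis
  Decomposable-⊆ L⊆M (disj m d e)     = disj (L⊆M m) (Decomposable-⊆ L⊆M d) (Decomposable-⊆ L⊆M e)

  ⋀ ⋁ : List (Formula V) → Formula V
  ⋀ = List.foldr _∧ᶠ_ ⊤ᶠ
  ⋁ = List.foldr _∨ᶠ_ ⊥ᶠ

  gateFormula : Gate V k → Vec (Formula V) k → Formula V
  gateFormula top       fs = ⊤ᶠ
  gateFormula bot       fs = ⊥ᶠ
  gateFormula (lit b x) fs = literal b x
  gateFormula (and cs)  fs = ⋀ (map (lookup fs) cs)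
  gateFormula (or cs)   fs = ⋁ (map (lookup fs) cs)

  formulas : Circ V k → Vec (Formula V) k
  formulas []      = []
  formulas (C ▷ g) = formulas C ∷ʳ gateFormula g (formulas C)

  -- The suffixes of the list of children make gates binary, at the cost of one formula per edge.
  gateSubformulas : Gate V k → Vec (Formula V) k → List (Formula V)
  gateSubformulas (and cs) fs = map ⋀ (List.tails (map (lookup fs) cs))
  gateSubformulas (or cs)  fs = map ⋁ (List.tails (map (lookup fs) cs))
  gateSubformulas g        fs = gateFormula g fs ∷ []

  subformulas : Circ V k → List (Formula V)
  subformulas []      = []
  subformulas (C ▷ g) = subformulas C ++ gateSubformulas g (formulas C)

  length-tails : ∀ {A : Set} (xs : List A) → length (List.tails xs) ≡ suc (length xs)
  length-tails []       = refl
  length-tails (x ∷ xs) = cong suc (length-tails xs)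

  length-gateSubformulas : ∀ (g : Gate V k) fs → length (gateSubformulas g fs) ≡ suc (gateEdges g)
  length-gateSubformulas top       fs = refl
  length-gateSubformulas bot       fs = refl
  length-gateSubformulas (lit _ _) fs = refl
  length-gateSubformulas (and cs)  fs = trans (length-map ⋀ (List.tails (map (lookup fs) cs)))
    (trans (length-tails (map (lookup fs) cs)) (cong suc (length-map (lookup fs) cs)))
  length-gateSubformulas (or cs)   fs = trans (length-map ⋁ (List.tails (map (lookup fs) cs)))
    (trans (length-tails (map (lookup fs) cs)) (cong suc (length-map (lookup fs) cs)))

  length-subformulas : ∀ (C : Circ V k) → length (subformulas C) ≡ size C
  length-subformulas []      = refl
  length-subformulas (C ▷ g) = trans (length-++ (subformulas C))
    (cong₂ _+_ (length-subformulas C) (length-gateSubformulas g (formulas C)))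

  gateFormula-⟦⟧ : ∀ (g : Gate V k) fs α →
                   gateVal g α (Vec.map (λ φ → ⟦ φ ⟧ α) fs) ≡ ⟦ gateFormula g fs ⟧ α
  gateFormula-⟦⟧ top           fs α = refl
  gateFormula-⟦⟧ bot           fs α = refl
  gateFormula-⟦⟧ (lit true x)  fs α = refl
  gateFormula-⟦⟧ (lit false x) fs α = refl
  gateFormula-⟦⟧ (and [])       fs α = refl
  gateFormula-⟦⟧ (and (c ∷ cs)) fs α = cong₂ _∧_ (lookup-map c _ fs) (gateFormula-⟦⟧ (and cs) fs α)
  gateFormula-⟦⟧ (or [])        fs α = refl
  gateFormula-⟦⟧ (or (c ∷ cs))  fs α = cong₂ _∨_ (lookup-map c _ fs) (gateFormula-⟦⟧ (or cs) fs α)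

  formulas-⟦⟧ : ∀ (C : Circ V k) α → values C α ≡ Vec.map (λ φ → ⟦ φ ⟧ α) (formulas C)
  formulas-⟦⟧ []      α = refl
  formulas-⟦⟧ (C ▷ g) α rewrite formulas-⟦⟧ C α = trans
    (cong (_ ∷ʳ_) (gateFormula-⟦⟧ g (formulas C) α)) (sym (map-∷ʳ _ _ (formulas C)))

  gateFormula-vars : ∀ (g : Gate V k) fs → gateVars g (Vec.map vars fs) ≡ vars (gateFormula g fs)
  gateFormula-vars top           fs = refl
  gateFormula-vars bot           fs = refl
  gateFormula-vars (lit _ x)     fs = refl
  gateFormula-vars (and [])       fs = refl
  gateFormula-vars (and (c ∷ cs)) fs = cong₂ _++_ (lookup-map c _ fs) (gateFormula-vars (and cs) fs)
  gateFormula-vars (or [])        fs = refl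
  gateFormula-vars (or (c ∷ cs))  fs = cong₂ _++_ (lookup-map c _ fs) (gateFormula-vars (or cs) fs)

  formulas-vars : ∀ (C : Circ V k) → varsAll C ≡ Vec.map vars (formulas C)
  formulas-vars []      = refl
  formulas-vars (C ▷ g) rewrite formulas-vars C = trans
    (cong (_ ∷ʳ_) (gateFormula-vars g (formulas C))) (sym (map-∷ʳ vars _ (formulas C)))

  -- `DecompGate` compares two child positions, so a variable of the remaining conjunction has to be
  -- traced back to one child.
  ∈-vars-⋀ : ∀ (fs : Vec (Formula V) k) cs {x} → x ∈ vars (⋀ (map (lookup fs) cs)) →
             ∃[ p ] x ∈ lookup (Vec.map vars fs) (List.lookup cs p)
  ∈-vars-⋀ fs (c ∷ cs) x∈ with ∈-++⁻ (vars (lookup fs c)) x∈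
  ... | inj₁ x∈c = zero , subst (_ ∈_) (sym (lookup-map c vars fs)) x∈c
  ... | inj₂ x∈cs with ∈-vars-⋀ fs cs x∈cs
  ...   | p , x∈p = suc p , x∈p

  ⋀-decomposable : ∀ {fs : Vec (Formula V) k} → All (Decomposable L) fs → ∀ cs →
                   DecompGate (and cs) (Vec.map vars fs) →
                   map ⋀ (List.tails (map (lookup fs) cs)) ⊆ L →
                   Decomposable L (⋀ (map (lookup fs) cs))
  ⋀-decomposable ds []       disjoint ⊆L = top (⊆L (here refl))
  ⋀-decomposable {fs = fs} ds (c ∷ cs) disjoint ⊆L = conj (⊆L (here refl)) (lookup⁺ ds c)
    (⋀-decomposable ds cs (λ p q p≢q → disjoint (suc p) (suc q) (p≢q ∘ Fin.suc-injective)) (⊆L ∘ there))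
    λ x∈c x∈cs → let p , x∈p = ∈-vars-⋀ fs cs x∈cs in
      disjoint zero (suc p) (λ ()) _ (subst (_ ∈_) (sym (lookup-map c vars fs)) x∈c) x∈p

  ⋁-decomposable : ∀ {fs : Vec (Formula V) k} → All (Decomposable L) fs → ∀ cs →
                   map ⋁ (List.tails (map (lookup fs) cs)) ⊆ L →
                   Decomposable L (⋁ (map (lookup fs) cs))
  ⋁-decomposable ds []       ⊆L = bot (⊆L (here refl))
  ⋁-decomposable ds (c ∷ cs) ⊆L =
    disj (⊆L (here refl)) (lookup⁺ ds c) (⋁-decomposable ds cs (⊆L ∘ there))

  gateFormula-decomposable : ∀ {fs : Vec (Formula V) k} → All (Decomposable L) fs → ∀ g →
                             DecompGate g (Vec.map vars fs) → gateSubformulas g fs ⊆ L →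
                             Decomposable L (gateFormula g fs)
  gateFormula-decomposable ds top       _        ⊆L = top (⊆L (here refl))
  gateFormula-decomposable ds bot       _        ⊆L = bot (⊆L (here refl))
  gateFormula-decomposable ds (lit b x) _        ⊆L = lit (⊆L (here refl))
  gateFormula-decomposable ds (and cs)  disjoint ⊆L = ⋀-decomposable ds cs disjoint ⊆L
  gateFormula-decomposable ds (or cs)   _        ⊆L = ⋁-decomposable ds cs ⊆L

  ∷ʳ⁺ : ∀ {A : Set} {P : A → Set} {xs : Vec A k} {x} → All P xs → P x → All P (xs ∷ʳ x)
  ∷ʳ⁺ []         px = px ∷ []
  ∷ʳ⁺ (py ∷ pxs) px = py ∷ ∷ʳ⁺ pxs px

  formulas-decomposable : ∀ (C : Circ V k) → IsDNNF C → All (Decomposable (subformulas C)) (formulas C)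
  formulas-decomposable []      _       = []
  formulas-decomposable (C ▷ g) (d , e) = ∷ʳ⁺ old
    (gateFormula-decomposable old g (subst (DecompGate g) (formulas-vars C) e) (∈-++⁺ʳ (subformulas C)))
    where
    old : All (Decomposable (subformulas (C ▷ g))) (formulas C)
    old = All.map (Decomposable-⊆ ∈-++⁺ˡ) (formulas-decomposable C d)

-- Descent to a balanced subformula

abstract
  _≟ᵛ_ : DecidableEquality (Var n)
  _≟ᵛ_ = ≡-dec (≡-dec Fin._≟_ Fin._≟_) λ p q → yes (Fin.<-irrelevant p q)

open module VarMembership {n} = DecMembership (_≟ᵛ_ {n}) using () renaming (_∈?_ to _∈ᵛ?_)

mentions : Formula (Var n) → Var n → Bool
mentions φ x = does (x ∈ᵛ? vars φ)

mentions⇒∈ : ∀ (φ : Formula (Var n)) {x} → mentions φ x ≡ true → x ∈ vars φ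
mentions⇒∈ φ {x} eq with x ∈ᵛ? vars φ
... | yes x∈ = x∈

¬mentions⇒∉ : ∀ (φ : Formula (Var n)) {x} → mentions φ x ≡ false → x ∉ vars φ
¬mentions⇒∉ φ {x} eq with x ∈ᵛ? vars φ
... | no x∉ = x∉

mix-∈ : ∀ (φ : Formula (Var n)) α β {x} → x ∈ vars φ → mix (mentions φ) β α x ≡ β x
mix-∈ φ α β {x} x∈ rewrite dec-true (x ∈ᵛ? vars φ) x∈ = refl

mix-∉ : ∀ (φ : Formula (Var n)) α β {x} → x ∉ vars φ → mix (mentions φ) β α x ≡ α x
mix-∉ φ α β {x} x∉ rewrite dec-false (x ∈ᵛ? vars φ) x∉ = refl

⟦⟧-mix : ∀ (φ : Formula (Var n)) α β → ⟦ φ ⟧ β ≡ true → ⟦ φ ⟧ (mix (mentions φ) β α) ≡ true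
⟦⟧-mix φ α β h = trans (⟦⟧-local φ (mix-∈ φ α β)) h

∨-trueˡ : ∀ {a} b → a ≡ true → a ∨ b ≡ true
∨-trueˡ b refl = refl

∨-trueʳ : ∀ a {b} → b ≡ true → a ∨ b ≡ true
∨-trueʳ true  refl = refl
∨-trueʳ false refl = refl

module _ (T : Triangle n) where
  open Triangle T

  makeCyclic : Assignment n → Assignment n
  makeCyclic α x = if does (x ≟ᵛ ik) then false else
               if does (x ≟ᵛ ij) ∨ does (x ≟ᵛ jk) then true else α x

  ij≢ik : ij ≢ ik
  ij≢ik eq = ℕ.<⇒≢ j<k (cong (toℕ ∘ proj₂ ∘ proj₁) eq)

  jk≢ik : jk ≢ ik
  jk≢ik eq = ℕ.<⇒≢ i<j (sym (cong (toℕ ∘ proj₁ ∘ proj₁) eq))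

  ij≢jk : ij ≢ jk
  ij≢jk eq = ℕ.<⇒≢ i<j (cong (toℕ ∘ proj₁ ∘ proj₁) eq)

  makeCyclic-cyclic : ∀ α → Cyclic (makeCyclic α) T
  makeCyclic-cyclic α = ij-true , jk-true , ik-false
    where
    ij-true : makeCyclic α ij ≡ true
    ij-true rewrite dec-false (ij ≟ᵛ ik) ij≢ik | dec-true (ij ≟ᵛ ij) refl = refl
    jk-true : makeCyclic α jk ≡ true
    jk-true rewrite dec-false (jk ≟ᵛ ik) jk≢ik | dec-false (jk ≟ᵛ ij) (ij≢jk ∘ sym)
                  | dec-true (jk ≟ᵛ jk) refl = refl
    ik-false : makeCyclic α ik ≡ false
    ik-false rewrite dec-true (ik ≟ᵛ ik) refl = refl

  makeCyclic-away : ∀ α x → x ≢ ij → x ≢ jk → x ≢ ik → makeCyclic α x ≡ α x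
  makeCyclic-away α x x≢ij x≢jk x≢ik rewrite dec-false (x ≟ᵛ ik) x≢ik
    | dec-false (x ≟ᵛ ij) x≢ij | dec-false (x ≟ᵛ jk) x≢jk = refl

  Avoids : Formula (Var n) → Set
  Avoids φ = mentions φ ij ≡ false × mentions φ jk ≡ false × mentions φ ik ≡ false

  ⟦⟧-makeCyclic : ∀ φ → Avoids φ → ∀ {α} → ⟦ φ ⟧ α ≡ true → ⟦ φ ⟧ (makeCyclic α) ≡ true
  ⟦⟧-makeCyclic φ (ij∉ , jk∉ , ik∉) {α} h = trans (⟦⟧-local φ agree) h
    where
    agree : ∀ {x} → x ∈ vars φ → makeCyclic α x ≡ α x
    agree {x} x∈ = makeCyclic-away α x (λ { refl → ¬mentions⇒∉ φ ij∉ x∈ })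
      (λ { refl → ¬mentions⇒∉ φ jk∉ x∈ }) (λ { refl → ¬mentions⇒∉ φ ik∉ x∈ })

module Descent {n t} (large : 2 + 9 * t < n) (ρ : Formula (Var n))
  (acyclic : ∀ α → ⟦ ρ ⟧ α ≡ true → ∀ T → ¬ Cyclic α T) where

  open Colouring using (Packing; Homogeneous; dichotomy)

  -- Semantic substitute for a proof tree of α through φ; the models α of φ with this property form
  -- the rectangle of φ.
  Replaceable : Formula (Var n) → Assignment n → Set
  Replaceable φ α = ∀ β → ⟦ φ ⟧ β ≡ true → ⟦ ρ ⟧ (mix (mentions φ) β α) ≡ true

  -- `Almost true` is full and `Almost false` is empty, up to the exceptional vertices in `D`.
  Almost : Bool → Formula (Var n) → Set
  Almost b φ = ∃[ D ] length D ≤ 3 * t × Homogeneous (mentions φ) b D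

  record Balanced (L : List (Formula (Var n))) (α : Assignment n) : Set where
    field
      φ           : Formula (Var n)
      φ∈L         : φ ∈ L
      holds       : ⟦ φ ⟧ α ≡ true
      replaceable : Replaceable φ α
      packing     : Packing (mentions φ) [] t

  homogeneous-triangle : ∀ {b} φ {D : List (Fin n)} → Homogeneous (mentions φ) b D → ∀ T → Outside D T →
    let open Triangle T in mentions φ ij ≡ b × mentions φ jk ≡ b × mentions φ ik ≡ b
  homogeneous-triangle φ h T (i∉ , j∉ , k∉) = h i<j i∉ j∉ , h j<k j∉ k∉ , h i<k i∉ k∉
    where open Triangle T

  abstract
    -- At most three exceptional sets have to be avoided at once, those of a conjunction and of its
    -- two conjuncts. This is the source of `9 * t` in `large`.
    triangleOutside : ∀ (D E F : List (Fin n)) → length D ≤ 3 * t → length E ≤ 3 * t → length F ≤ 3 * t →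
                      ∃[ T ] Outside D T × Outside E T × Outside F T
    triangleOutside D E F D≤ E≤ F≤ with freshTriangle (D ++ E ++ F) (ℕ.≤-<-trans (ℕ.+-monoʳ-≤ 2 small) large)
      where
      open ℕ.≤-Reasoning
      nine : ∀ t → 3 * t + (3 * t + 3 * t) ≡ 9 * t
      nine t = sym (trans (ℕ.*-distribʳ-+ t 3 6) (cong (3 * t +_) (ℕ.*-distribʳ-+ t 3 3)))
      small : length (D ++ E ++ F) ≤ 9 * t
      small = begin
        length (D ++ E ++ F)             ≡⟨ length-++ D ⟩
        length D + length (E ++ F)       ≡⟨ cong (length D +_) (length-++ E) ⟩
        length D + (length E + length F) ≤⟨ ℕ.+-mono-≤ D≤ (ℕ.+-mono-≤ E≤ F≤) ⟩
        3 * t + (3 * t + 3 * t)          ≡⟨ nine t ⟩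
        9 * t                            ∎
    ... | T , out = T , Outside-++⁻ˡ D T out , Outside-++⁻ˡ E T (Outside-++⁻ʳ D T out)
                      , Outside-++⁻ʳ E T (Outside-++⁻ʳ D T out)

  abstract
    classify : ∀ φ → Packing (mentions φ) [] t ⊎ (Almost true φ ⊎ Almost false φ)
    classify φ with dichotomy (mentions φ) t (ℕ.≤-<-trans (ℕ.+-monoʳ-≤ 2 (ℕ.*-monoˡ-≤ t 3≤9)) large)
      where
      3≤9 : 3 ≤ 9
      3≤9 = s≤s (s≤s (s≤s z≤n))
    ... | inj₁ P = inj₁ P
    ... | inj₂ (true  , full)  = inj₂ (inj₁ full)
    ... | inj₂ (false , empty) = inj₂ (inj₂ empty)

  -- Since `vars φ` is contained in `vars ψ`, writing the mix for `φ` into `α` on `vars ψ` just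
  -- yields that mix, so replacing inside `φ` is an instance of replacing inside `ψ`.
  Replaceable-sub : ∀ φ ψ {α} → vars φ ⊆ vars ψ →
    (∀ β → ⟦ φ ⟧ β ≡ true → ⟦ ψ ⟧ (mix (mentions φ) β α) ≡ true) → Replaceable ψ α → Replaceable φ α
  Replaceable-sub φ ψ {α} φ⊆ψ φ⇒ψ rep β h =
    trans (⟦⟧-local ρ λ {x} _ → sym (collapse x)) (rep (mix (mentions φ) β α) (φ⇒ψ β h))
    where
    collapse : ∀ x → mix (mentions ψ) (mix (mentions φ) β α) α x ≡ mix (mentions φ) β α x
    collapse x with x ∈ᵛ? vars ψ
    ... | yes _  = refl
    ... | no  x∉ = sym (mix-∉ φ α β (x∉ ∘ φ⊆ψ))

  -- An edge of ψ not mentioned by φ can be reoriented freely, so φ cannot forget a whole triangle.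
  no-collapse : ∀ {φ ψ α} → (∀ β → ⟦ φ ⟧ β ≡ true → ⟦ ψ ⟧ β ≡ true) → ⟦ φ ⟧ α ≡ true →
                Replaceable ψ α → Almost true ψ → ¬ Almost false φ
  no-collapse {φ} {ψ} {α} φ⇒ψ h rep (D , D≤ , full) (E , E≤ , empty)
    with triangleOutside D E [] D≤ E≤ z≤n
  ... | T , outD , outE , _ with homogeneous-triangle ψ full T outD | makeCyclic-cyclic T α
  ... | ij∈ , jk∈ , ik∈ | ij≡ , jk≡ , ik≡ =
    acyclic _ (rep (makeCyclic T α) (φ⇒ψ _ (⟦⟧-makeCyclic T φ (homogeneous-triangle φ empty T outE) h))) T
      ( trans (mix-∈ ψ α (makeCyclic T α) (mentions⇒∈ ψ ij∈)) ij≡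
      , trans (mix-∈ ψ α (makeCyclic T α) (mentions⇒∈ ψ jk∈)) jk≡
      , trans (mix-∈ ψ α (makeCyclic T α) (mentions⇒∈ ψ ik∈)) ik≡ )

  module _ {L : List (Formula (Var n))} {α : Assignment n} where

    -- Classifies a satisfied node, continues the walk below a full one, and leaves an empty one to
    -- the caller.
    visit : ∀ {φ} → Decomposable L φ → ⟦ φ ⟧ α ≡ true → Replaceable φ α → Balanced L α ⊎ Almost false φ

    -- Recursion on the `Decomposable` derivation. A leaf mentions at most one variable and so
    -- cannot be full; a full inner node has a satisfied child that is not empty.
    descend : ∀ {φ} → Decomposable L φ → ⟦ φ ⟧ α ≡ true → Replaceable φ α → Almost true φ → Balanced L α

    visit {φ} d h rep with classify φ
    ... | inj₁ P = inj₁ record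
      { φ = φ ; φ∈L = Decomposable⇒∈ d ; holds = h ; replaceable = rep ; packing = P }
    ... | inj₂ (inj₁ full)  = inj₁ (descend d h rep full)
    ... | inj₂ (inj₂ empty) = inj₂ empty

    descend (top _) h rep (D , D≤ , full) with triangleOutside D [] [] D≤ z≤n z≤n
    ... | T , out , _ = contradiction (proj₁ (homogeneous-triangle ⊤ᶠ full T out)) λ ()
    descend {literal b x} (lit _) h rep (D , D≤ , full) with triangleOutside D [] [] D≤ z≤n z≤n
    ... | T , out , _ with homogeneous-triangle (literal b x) full T out
    ... | ij∈ , jk∈ , _ with mentions⇒∈ (literal b x) ij∈ | mentions⇒∈ (literal b x) jk∈
    ... | here ij≡x | here jk≡x = contradiction (trans ij≡x (sym jk≡x)) (ij≢jk T)
    descend {φ ∧ᶠ ψ} (conj _ d e disjoint) h rep (D , D≤ , full)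
      with ⟦ φ ⟧ α in hφ | ⟦ ψ ⟧ α in hψ
    ... | true | true
      -- By disjointness, changing `α` on the variables of one conjunct leaves the other conjunct
      -- true, so replaceability passes to both.
      with visit d hφ (Replaceable-sub φ (φ ∧ᶠ ψ) ∈-++⁺ˡ (λ β hβ → cong₂ _∧_ (⟦⟧-mix φ α β hβ)
             (trans (⟦⟧-local ψ λ x∈ψ → mix-∉ φ α β (λ x∈φ → disjoint x∈φ x∈ψ)) hψ)) rep)
         | visit e hψ (Replaceable-sub ψ (φ ∧ᶠ ψ) (∈-++⁺ʳ (vars φ)) (λ β hβ → cong₂ _∧_
             (trans (⟦⟧-local φ λ x∈φ → mix-∉ ψ α β (disjoint x∈φ)) hφ) (⟦⟧-mix ψ α β hβ)) rep)
    ... | inj₁ found | _ = found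
    ... | _ | inj₁ found = found
    -- If both conjuncts were empty, an edge outside all three exceptional sets would occur in the
    -- conjunction but in neither conjunct.
    ... | inj₂ (E , E≤ , emptyφ) | inj₂ (F , F≤ , emptyψ) with triangleOutside D E F D≤ E≤ F≤
    ... | T , outD , outE , outF
      with ∈-++⁻ (vars φ) (mentions⇒∈ (φ ∧ᶠ ψ) (proj₁ (homogeneous-triangle (φ ∧ᶠ ψ) full T outD)))
    ... | inj₁ ij∈φ = contradiction ij∈φ (¬mentions⇒∉ φ (proj₁ (homogeneous-triangle φ emptyφ T outE)))
    ... | inj₂ ij∈ψ = contradiction ij∈ψ (¬mentions⇒∉ ψ (proj₁ (homogeneous-triangle ψ emptyψ T outF)))
    descend {φ ∨ᶠ ψ} (disj _ d e) h rep full with ⟦ φ ⟧ α in hφ | ⟦ ψ ⟧ α in hψ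
    -- The walk enters a disjunct true under `α`; by `no-collapse` it is not empty.
    ... | true | _ = [ id , flip contradiction
        (no-collapse {φ} {φ ∨ᶠ ψ} (λ β → ∨-trueˡ (⟦ ψ ⟧ β)) hφ rep full) ]′
      (visit d hφ (Replaceable-sub φ (φ ∨ᶠ ψ) ∈-++⁺ˡ (λ β hβ → ∨-trueˡ _ (⟦⟧-mix φ α β hβ)) rep))
    ... | false | true = [ id , flip contradiction
        (no-collapse {ψ} {φ ∨ᶠ ψ} (λ β → ∨-trueʳ (⟦ φ ⟧ β)) hψ rep full) ]′
      (visit e hψ (Replaceable-sub ψ (φ ∨ᶠ ψ) (∈-++⁺ʳ (vars φ)) (λ β hβ → ∨-trueʳ (⟦ φ ⟧ _) (⟦⟧-mix ψ α β hβ)) rep))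

  -- The walk starts at `ρ`, which is replaceable in its own models. It is not empty: otherwise a
  -- triangle it does not mention could be made cyclic without falsifying it.
  balanced : ∀ {L} → Decomposable L ρ → ∀ α → ⟦ ρ ⟧ α ≡ true → Balanced L α
  balanced d α h with visit d h (⟦⟧-mix ρ α)
  ... | inj₁ found = found
  ... | inj₂ (D , D≤ , empty) with triangleOutside D [] [] D≤ z≤n z≤n
  ... | T , out , _ = contradiction (makeCyclic-cyclic T α)
    (acyclic _ (⟦⟧-makeCyclic T ρ (homogeneous-triangle ρ empty T out) h) T)

  -- `order f` satisfies `φ`, and `order g` accepts any model of `φ` on `vars φ`; the mix is
  -- therefore a model of `ρ`.
  balanced-rectangle : ∀ {L φ} f g (bf : Balanced L (order f)) (bg : Balanced L (order g)) →
    Balanced.φ bf ≡ φ → Balanced.φ bg ≡ φ → ∀ T → ¬ Cyclic (mix (mentions φ) (order f) (order g)) T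
  balanced-rectangle f g bf bg refl eq =
    acyclic _ (subst (λ ψ → Replaceable ψ (order g)) eq (Balanced.replaceable bg) _ (Balanced.holds bf))

  -- The bit strings are sorted by the node at which their walk stops. Each class lies in one good
  -- rectangle, and there are at most `length L` classes.
  cover : ∀ {L} → Decomposable L ρ → (∀ f → ⟦ ρ ⟧ (order f) ≡ true) → 8 ^ t ≤ length L * 7 ^ t
  cover {L} d models = ℕ.*-cancelʳ-≤ (8 ^ t) (length L * 7 ^ t) (2 ^ n) {{ℕ.m^n≢0 2 n}} (begin
    8 ^ t * 2 ^ n                                 ≤⟨ cover-bound fibre (allFin (length L)) covered (8 ^ t) (7 ^ t * 2 ^ n) bound ⟩
    length (allFin (length L)) * (7 ^ t * 2 ^ n)  ≡⟨ cong (_* _) (length-tabulate {n = length L} id) ⟩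
    length L * (7 ^ t * 2 ^ n)                    ≡⟨ ℕ.*-assoc (length L) _ _ ⟨
    length L * 7 ^ t * 2 ^ n                      ∎)
    where
    open ℕ.≤-Reasoning
    b : ∀ f → Balanced L (order f)
    b f = balanced d (order f) (models f)
    -- Classes are indexed by positions in `L`, so that comparing them means comparing elements of
    -- `Fin` and not formulas.
    position : Vec Bool n → Fin (length L)
    position f = index (Balanced.φ∈L (b f))
    fibre : Fin (length L) → Vec Bool n → Bool
    fibre r f = does (position f Fin.≟ r)
    covered : ∀ f → Any (λ r → fibre r f ≡ true) (allFin (length L))
    covered f = lose (∈-allFin (position f)) (dec-true (position f Fin.≟ position f) refl)
    fibre-φ : ∀ r f → fibre r f ≡ true → Balanced.φ (b f) ≡ List.lookup L r
    fibre-φ r f eq with position f Fin.≟ r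
    ... | yes refl = lookup-index (Balanced.φ∈L (b f))
    bound : ∀ r → 8 ^ t * cubeSum (indicator ∘ fibre r) ≤ 7 ^ t * 2 ^ n
    -- The packing for position `r` is taken from any member of the class; a class without members
    -- contributes 0.
    bound r with anyVec? (fibre r)
    ... | yes (f , eq) = rectangle-bound (mentions (List.lookup L r)) (fibre r)
      (λ g h eqg eqh → balanced-rectangle g h (b g) (b h) (fibre-φ r g eqg) (fibre-φ r h eqh))
      (subst (λ φ → Packing (mentions φ) [] t) (fibre-φ r f eq) (Balanced.packing (b f)))
    ... | no none = begin
      8 ^ t * cubeSum (indicator ∘ fibre r)  ≤⟨ ℕ.*-monoʳ-≤ (8 ^ t) (cubeSum-mono zeroes) ⟩
      8 ^ t * cubeSum {n} (λ _ → 0)          ≡⟨ cong (8 ^ t *_) (cubeSum-const {n} 0) ⟩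
      8 ^ t * (2 ^ n * 0)                    ≡⟨ cong (8 ^ t *_) (ℕ.*-zeroʳ (2 ^ n)) ⟩
      8 ^ t * 0                              ≡⟨ ℕ.*-zeroʳ (8 ^ t) ⟩
      0                                      ≤⟨ z≤n ⟩
      7 ^ t * 2 ^ n                          ∎
      where
      zeroes : ∀ f → indicator (fibre r f) ≤ 0
      zeroes f with fibre r f in eq
      ... | false = z≤n
      ... | true  = contradiction (f , eq) none

-- The circuit bound and its constants

circuit-bound : ∀ {m} → 2 + 9 * t < n → (C : Circ (Var n) (suc m)) → IsDNNF C → ExpressesLin n C →
                8 ^ t ≤ size C * 7 ^ t
circuit-bound {t} {n} {m} large C dnnf expresses = subst (λ s → 8 ^ t ≤ s * 7 ^ t) (length-subformulas C)
  (Descent.cover {t = t} large root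
    (λ α h → Lin⇒¬Cyclic (Equivalence.to (expresses α) (trans (eval≡ α) h)))
    (lookup⁺ (formulas-decomposable C dnnf) (fromℕ m))
    (λ f → trans (sym (eval≡ (order f))) (Equivalence.from (expresses (order f)) (order-Lin f))))
  where
  root : Formula (Var n)
  root = lookup (formulas C) (fromℕ m)
  eval≡ : ∀ α → eval C α ≡ ⟦ root ⟧ α
  eval≡ α = trans (cong (λ vs → lookup vs (fromℕ m)) (formulas-⟦⟧ C α))
                  (lookup-map (fromℕ m) _ (formulas C))

^-distribʳ-* : ∀ e a b → (a * b) ^ e ≡ a ^ e * b ^ e
^-distribʳ-* zero    a b = refl
^-distribʳ-* (suc e) a b = trans (cong (a * b *_) (^-distribʳ-* e a b)) (interchange a b (a ^ e) (b ^ e))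
  where
  interchange : ∀ a b c d → a * b * (c * d) ≡ a * c * (b * d)
  interchange = solve-∀

^-comm : ∀ a d e → (a ^ d) ^ e ≡ (a ^ e) ^ d
^-comm a d e = trans (ℕ.^-*-assoc a d e) (trans (cong (a ^_) (ℕ.*-comm d e)) (sym (ℕ.^-*-assoc a e d)))

-- The sixth power turns the base 8/7 into at least 2: `2 * 7 ^ 6 ≤ 8 ^ 6` holds by computation,
-- while the fifth power falls short.
2^t≤s^6 : ∀ t s → 8 ^ t ≤ s * 7 ^ t → 2 ^ t ≤ s ^ 6
2^t≤s^6 t s le = ℕ.*-cancelʳ-≤ (2 ^ t) (s ^ 6) ((7 ^ t) ^ 6) {{ℕ.m^n≢0 (7 ^ t) 6 {{ℕ.m^n≢0 7 t}}}} (begin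
  2 ^ t * (7 ^ t) ^ 6  ≡⟨ cong (2 ^ t *_) (^-comm 7 t 6) ⟩
  2 ^ t * (7 ^ 6) ^ t  ≡⟨ ^-distribʳ-* t 2 (7 ^ 6) ⟨
  (2 * 7 ^ 6) ^ t      ≤⟨ ℕ.^-monoˡ-≤ t (ℕ.≤ᵇ⇒≤ (2 * 7 ^ 6) (8 ^ 6) tt) ⟩
  (8 ^ 6) ^ t          ≡⟨ ^-comm 8 6 t ⟩
  (8 ^ t) ^ 6          ≤⟨ ℕ.^-monoˡ-≤ 6 le ⟩
  (s * 7 ^ t) ^ 6      ≡⟨ ^-distribʳ-* 6 s (7 ^ t) ⟩
  s ^ 6 * (7 ^ t) ^ 6  ∎)
  where open ℕ.≤-Reasoning

module _ (n : ℕ) (30≤n : 30 ≤ n) where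

  private
    q r : ℕ
    q = n / 10
    r = n % 10

  n≡ : n ≡ r + q * 10
  n≡ = m≡m%n+[m/n]*n n 10

  3≤n/10 : 3 ≤ q
  3≤n/10 = ℕ.≮⇒≥ λ q<3 → ℕ.<⇒≱ (begin-strict
    n           ≡⟨ n≡ ⟩
    r + q * 10  <⟨ ℕ.+-mono-<-≤ (m%n<n n 10) (ℕ.*-monoˡ-≤ 10 (ℕ.≤-pred q<3)) ⟩
    30          ∎) 30≤n
    where open ℕ.≤-Reasoning

  -- Here the threshold 30 enters: it gives `3 ≤ q`, and the tenth copy of `q` absorbs the 3.
  2+9*[n/10]<n : 2 + 9 * q < n
  2+9*[n/10]<n = begin
    3 + 9 * q   ≤⟨ ℕ.+-monoˡ-≤ (9 * q) 3≤n/10 ⟩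
    10 * q      ≡⟨ ℕ.*-comm 10 q ⟩
    q * 10      ≤⟨ ℕ.m≤n+m (q * 10) r ⟩
    r + q * 10  ≡⟨ n≡ ⟨
    n           ∎
    where open ℕ.≤-Reasoning

  n≤[n/10]*20 : n ≤ q * 20
  n≤[n/10]*20 = begin
    n                ≡⟨ n≡ ⟩
    r + q * 10       ≤⟨ ℕ.+-monoˡ-≤ (q * 10) (ℕ.<⇒≤ (m%n<n n 10)) ⟩
    1 * 10 + q * 10  ≤⟨ ℕ.+-monoˡ-≤ (q * 10) (ℕ.*-monoˡ-≤ 10 (ℕ.≤-trans (s≤s z≤n) 3≤n/10)) ⟩
    q * 10 + q * 10  ≡⟨ ℕ.*-distribˡ-+ q 10 10 ⟨
    q * 20           ∎
    where open ℕ.≤-Reasoning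

2^n≤s^[a*b] : ∀ n t s a b → n ≤ t * b → 2 ^ t ≤ s ^ a → 2 ^ n ≤ s ^ (a * b)
2^n≤s^[a*b] n t s a b n≤tb le = begin
  2 ^ n          ≤⟨ ℕ.^-monoʳ-≤ 2 n≤tb ⟩
  2 ^ (t * b)    ≡⟨ ℕ.^-*-assoc 2 t b ⟨
  (2 ^ t) ^ b    ≤⟨ ℕ.^-monoˡ-≤ b le ⟩
  (s ^ a) ^ b    ≡⟨ ℕ.^-*-assoc s a b ⟩
  s ^ (a * b)    ∎
  where open ℕ.≤-Reasoning

theorem1 : Σ[ p ∈ ℕ ] Σ[ q ∈ ℕ ] (0 < p) × (0 < q) × (Σ[ n₀ ∈ ℕ ]
    ((n : ℕ) → n₀ ≤ n → (m : ℕ) (C : Circ (Var n) (ℕ.suc m)) →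
    IsDNNF C → ExpressesLin n C → 2 ^ (p * n) ≤ size C ^ q))
-- The constant is c = 1/120: with t = n / 10, the sixth power of the size is at least `2 ^ t`, and
-- n is at most 20 t.
theorem1 = 1 , 6 * 20 , s≤s z≤n , s≤s z≤n , 30 , λ n 30≤n m C dnnf expresses →
  subst (λ e → 2 ^ e ≤ size C ^ (6 * 20)) (sym (ℕ.*-identityˡ n))
    (2^n≤s^[a*b] n (n / 10) (size C) 6 20 (n≤[n/10]*20 n 30≤n)
      (2^t≤s^6 (n / 10) (size C) (circuit-bound {t = n / 10} (2+9*[n/10]<n n 30≤n) C dnnf expresses)))
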